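{- Let $p\ge 1$ be an integer and, for a positive integer $n$, let $g_{0,p}(n)$ be the number of functions $f:[n]\to[p]$ such that $f(i-1)+f(i+1)-2f(i)\le 0$ for all $i\in\{2,3,\ldots,n-1\}$. Then for every $n>2(p-1)$, $$g_{0,p}(n)=\sum_{m=1}^{p}\left(\sum_{j=0}^{m-1}a(j)\right)^2,$$ where $a(j)$ is the number of integer partitions of $j$.
   Context: $[n]=\{1,2,\ldots,n\}$. By the usual convention $a(0)=1$. -}

module Defs where

open import Data.Fin.Base using (Fin; toℕ; finToFun; funToFin)
import Data.Fin.Properties as Fin
open import Data.Integer.Base as ℤ using (+_; 0ℤ)
import Data.Integer.Properties as ℤ
open import Data.List.Base
  using (List; []; _∷_; [_]; length; lookup; map; filter; deduplicate;
         upTo; allFin; cartesianProductWith)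
import Data.List.Properties as List
open import Data.List.Membership.Propositional using (_∈_)
open import Data.List.Membership.Propositional.Properties
  using (∈-allFin; ∈-upTo⁺; ∈-cartesianProductWith⁺; ∈-lookup)
import Data.List.Membership.Setoid as SetoidMembership
import Data.List.Membership.Setoid.Properties as SetoidMembershipₚ
open import Data.List.Relation.Unary.All as All using (All; []; _∷_; all?)
import Data.List.Relation.Unary.All.Properties as Allₚ
open import Data.List.Relation.Unary.AllPairs using (_∷_)
open import Data.List.Relation.Unary.Any as Any using (here; there)
import Data.List.Relation.Unary.Any.Properties as Anyₚ
open import Data.List.Relation.Unary.Linked using (Linked; linked?)
import Data.List.Relation.Unary.Unique.Setoid as SetoidUnique
open import Data.List.Relation.Unary.Unique.DecSetoid.Properties using (deduplicate-!)
open import Data.Nat.Base using (ℕ; zero; suc; _≤_; _<_; _≥_; z≤n; s≤s; _^_)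
open import Data.Nat.ListAction using (sum)
import Data.Nat.Properties as ℕ
open import Data.Product.Base using (Σ; ∃; _×_; _,_; proj₁; proj₂)
import Data.Vec.Functional.Relation.Binary.Pointwise.Properties as Pointwise
open import Function.Bundles using (Inverse)
open import Level using (0ℓ)
open import Relation.Binary.Bundles using (Setoid; DecSetoid)
import Relation.Binary.Construct.On as On
open import Relation.Binary.Definitions using (_Respects_)
open import Relation.Binary.PropositionalEquality
  using (_≡_; refl; sym; cong; setoid)
open import Relation.Binary.PropositionalEquality.Properties using (decSetoid)
open import Relation.Nullary.Decidable using (_×-dec_; _→-dec_)
open import Relation.Nullary.Negation using (contradiction)
open import Relation.Unary using (Pred; Decidable)

-- Equality compares underlying elements only, so proofs of P are not counted.
Subset : (S : Setoid 0ℓ 0ℓ) → Pred (Setoid.Carrier S) 0ℓ → Setoid 0ℓ 0ℓ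
Subset S P = On.setoid {B = Σ (Setoid.Carrier S) P} S proj₁

Finite : Setoid 0ℓ 0ℓ → Set
Finite S = ∃ λ k → Inverse S (setoid (Fin k))

-- Does not depend on the bijection chosen: Fin k ↔ Fin l forces k ≡ l.
card : {S : Setoid 0ℓ 0ℓ} → Finite S → ℕ
card = proj₁

module _ (D : DecSetoid 0ℓ 0ℓ) where
  open DecSetoid D using (Carrier; _≈_; _≟_) renaming
    (setoid to S; refl to ≈-refl; sym to ≈-sym; trans to ≈-trans)
  open SetoidMembership S using () renaming (_∈_ to _∈ₛ_)
  open SetoidUnique S using (Unique)

  lookup-injective : ∀ {xs} → Unique xs → ∀ i j → lookup xs i ≈ lookup xs j → i ≡ j
  lookup-injective {_ ∷ _} (_ ∷ _)   Fin.zero    Fin.zero    _  = refl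
  lookup-injective {_ ∷ _} (x≉ ∷ _)  Fin.zero    (Fin.suc j) eq =
    contradiction eq (All.lookup x≉ (∈-lookup j))
  lookup-injective {_ ∷ _} (x≉ ∷ _)  (Fin.suc i) Fin.zero    eq =
    contradiction (≈-sym eq) (All.lookup x≉ (∈-lookup i))
  lookup-injective {_ ∷ _} (_ ∷ xs!) (Fin.suc i) (Fin.suc j) eq =
    cong Fin.suc (lookup-injective xs! i j eq)

  subset-finite : {P : Pred Carrier 0ℓ} → P Respects _≈_ → Decidable P →
                  (xs : List Carrier) → (∀ {x} → P x → x ∈ₛ xs) →
                  Finite (Subset S P)
  subset-finite {P} resp P? xs complete = length ys , record
    { to        = index
    ; from      = λ i → lookup ys i , All.lookup ys-P (∈-lookup i)
    ; to-cong   = λ {x} {y} x≈y → lookup-injective ys! (index x) (index y)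
                    (≈-trans (≈-sym (lookup-index x)) (≈-trans x≈y (lookup-index y)))
    ; from-cong = λ { refl → ≈-refl }
    ; inverse   =
        (λ {i} {x} x≈ → lookup-injective ys! (index x) i
                          (≈-trans (≈-sym (lookup-index x)) x≈))
      , (λ { {x} refl → ≈-sym (lookup-index x) })
    }
    where
    ys : List Carrier
    ys = deduplicate _≟_ (filter P? xs)

    ys! : Unique ys
    ys! = deduplicate-! D (filter P? xs)

    ys-P : All P ys
    ys-P = Allₚ.deduplicate⁺ _≟_ (Allₚ.all-filter P? xs)

    ∈ys : (x : Σ Carrier P) → proj₁ x ∈ₛ ys
    ∈ys (_ , px) = SetoidMembershipₚ.∈-deduplicate⁺ S _≟_
      (λ y≈z y≈w → ≈-trans y≈w (≈-sym y≈z))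
      (SetoidMembershipₚ.∈-filter⁺ S P? resp (complete px) px)

    index : Σ Carrier P → Fin (length ys)
    index x = Any.index (∈ys x)

    lookup-index : ∀ x → proj₁ x ≈ lookup ys (index x)
    lookup-index x = Anyₚ.lookup-index (∈ys x)

-- Fin k plays the role of [k] = {1, …, k}; ⟦ i ⟧ is the number i stands for.
⟦_⟧ : ∀ {k} → Fin k → ℕ
⟦ i ⟧ = suc (toℕ i)

-- h, i and j are the elements i - 1, i and i + 1 of [n]. Such h and j exist
-- exactly when 2 ≤ i ≤ n - 1.
Concave : ∀ {n p} → Pred (Fin n → Fin p) 0ℓ
Concave {n} f = ∀ (h i j : Fin n) → ⟦ i ⟧ ≡ suc ⟦ h ⟧ → ⟦ j ⟧ ≡ suc ⟦ i ⟧ →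
  (+ ⟦ f h ⟧ ℤ.+ + ⟦ f j ⟧) ℤ.- + 2 ℤ.* + ⟦ f i ⟧ ℤ.≤ 0ℤ

-- Functions are identified when they are pointwise equal.
Functions : ℕ → ℕ → DecSetoid 0ℓ 0ℓ
Functions n p = Pointwise.decSetoid (decSetoid (Fin._≟_ {p})) n

ConcaveFunctions : ℕ → ℕ → Setoid 0ℓ 0ℓ
ConcaveFunctions n p = Subset (DecSetoid.setoid (Functions n p)) Concave

concave-resp : ∀ {n p} → Concave {n} {p} Respects (DecSetoid._≈_ (Functions n p))
concave-resp f≗g c h i j i≡ j≡ rewrite sym (f≗g h) | sym (f≗g i) | sym (f≗g j) =
  c h i j i≡ j≡

concave? : ∀ {n p} → Decidable (Concave {n} {p})
concave? f = Fin.all? λ h → Fin.all? λ i → Fin.all? λ j →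
  (⟦ i ⟧ ℕ.≟ suc ⟦ h ⟧) →-dec ((⟦ j ⟧ ℕ.≟ suc ⟦ i ⟧) →-dec (_ ℤ.≤? 0ℤ))

concaveFunctions-finite : ∀ n p → Finite (ConcaveFunctions n p)
concaveFunctions-finite n p = subset-finite (Functions n p) concave-resp concave?
  (map finToFun (allFin (p ^ n)))
  λ {f} _ → Anyₚ.map⁺ (Any.map
    (λ { refl i → sym (Fin.finToFun-funToFin f i) })
    (∈-allFin (funToFin f)))

g₀ : (p n : ℕ) → ℕ
g₀ p n = card (concaveFunctions-finite n p)

-- A partition of j is the list of its parts in weakly decreasing order.
IsPartition : ℕ → Pred (List ℕ) 0ℓ
IsPartition j xs = All (0 <_) xs × Linked _≥_ xs × sum xs ≡ j

Partitions : ℕ → Setoid 0ℓ 0ℓ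
Partitions j = Subset (setoid (List ℕ)) (IsPartition j)

isPartition? : ∀ j → Decidable (IsPartition j)
isPartition? j xs =
  all? (0 ℕ.<?_) xs ×-dec linked? ℕ._≥?_ xs ×-dec (sum xs ℕ.≟ j)

boundedLists : (l b : ℕ) → List (List ℕ)
boundedLists zero    b = [ [] ]
boundedLists (suc l) b = [] ∷ cartesianProductWith _∷_ (upTo b) (boundedLists l b)

∈-boundedLists : ∀ {l b xs} → length xs ≤ l → All (_< b) xs → xs ∈ boundedLists l b
∈-boundedLists {zero}  z≤n       []         = here refl
∈-boundedLists {suc l} z≤n       []         = here refl
∈-boundedLists {suc l} (s≤s len) (x< ∷ xs<) =
  there (∈-cartesianProductWith⁺ _∷_ (∈-upTo⁺ x<) (∈-boundedLists len xs<))

length≤sum : ∀ {xs} → All (0 <_) xs → length xs ≤ sum xs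
length≤sum []           = z≤n
length≤sum (x>0 ∷ xs>0) = ℕ.+-mono-≤ x>0 (length≤sum xs>0)

all≤sum : ∀ xs → All (_≤ sum xs) xs
all≤sum []       = []
all≤sum (x ∷ xs) = ℕ.m≤m+n x (sum xs)
  ∷ All.map (λ y≤ → ℕ.≤-trans y≤ (ℕ.m≤n+m (sum xs) x)) (all≤sum xs)

partitions-finite : ∀ j → Finite (Partitions j)
partitions-finite j = subset-finite (decSetoid (List.≡-dec ℕ._≟_))
  (λ { refl px → px }) (isPartition? j) (boundedLists j (suc j))
  λ { {xs} (xs>0 , _ , refl) →
      ∈-boundedLists (length≤sum xs>0) (All.map s≤s (all≤sum xs)) }

a : ℕ → ℕ
a j = card (partitions-finite j)

-- Write n = N + 1 and p = c + 1, and index from 0. An increase (decrease) of a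
-- concave f : {0, …, N} → {1, …, p} at a position is preceded (followed) only
-- by increases (decreases), so there are at most c of each. As N ≥ 2c, f
-- is constant between positions c and N ∸ c, monotone before and antitone after,
-- and the sizes of the increases, and of the decreases read from the right, form
-- partitions λ and μ of numbers below the maximal value m. Conversely
--   f i = m − (λᵢ₊₁ + λᵢ₊₂ + ⋯) − (μ₍N₋ᵢ₎₊₁ + μ₍N₋ᵢ₎₊₂ + ⋯)
-- is concave for all such λ and μ, because tail sums of a decreasing sequence
-- are convex, and at every i one of the two tails is empty, so f i ≥ 1.
module Submission where

open import Defs
open import Data.Fin.Base using (Fin; toℕ; fromℕ<)
import Data.Fin.Properties as Fin
open import Data.Fin.Permutation using (↔⇒≡)
open import Data.Integer.Base as ℤ using (+_; 0ℤ)
import Data.Integer.Properties as ℤ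
open import Data.List.Base using (List; []; _∷_; length; map; upTo; drop; applyUpTo)
open import Data.List.Properties using (map-upTo; map-∘; drop-[]; drop-all)
open import Data.List.Relation.Unary.All using (All; []; _∷_)
open import Data.List.Relation.Unary.Linked using (Linked; []; [-]; _∷_)
open import Data.Nat.Base
open import Data.Nat.ListAction using (sum)
open import Data.Nat.Properties
open import Data.Nat.Tactic.RingSolver using (solve-∀)
open import Data.Product.Base using (Σ; ∃; _×_; _,_; proj₁; proj₂)
open import Data.Product.Function.NonDependent.Propositional using (_×-↔_)
open import Data.Sum.Base using (_⊎_; inj₁; inj₂)
open import Data.Sum.Function.Propositional using (_⊎-↔_)
open import Function.Base using (_∘_)
open import Function.Bundles using (Inverse; Bijection; Equivalence; _⇔_; mk⇔; _↔_; mk↔ₛ′)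
import Function.Construct.Composition as Compose
open import Function.Properties.Bijection using (Bijection⇒Inverse)
open import Function.Properties.Inverse using (↔-refl; ↔-sym; ↔-trans)
open import Relation.Binary.PropositionalEquality
open import Relation.Nullary.Negation using (contradiction)

-- Tail sums: the shortfall from the maximum on one side of the plateau.

deficit : List ℕ → ℕ → ℕ
deficit xs i = sum (drop i xs)

deficit-[] : ∀ i → deficit [] i ≡ 0
deficit-[] i = cong sum (drop-[] i)

deficit-vanishes : ∀ xs {i} → length xs ≤ i → deficit xs i ≡ 0
deficit-vanishes xs {i} len = cong sum (drop-all i xs len)

deficit≤sum : ∀ xs i → deficit xs i ≤ sum xs
deficit≤sum xs       zero    = ≤-refl
deficit≤sum []       (suc i) = z≤n
deficit≤sum (x ∷ xs) (suc i) = ≤-trans (deficit≤sum xs i) (m≤n+m (sum xs) x)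

-- The second difference at `i` is the entry at `i` minus the next one, with 0 read past the end of
-- the list.
deficit-convex : ∀ {xs} → Linked _≥_ xs → ∀ i →
  2 * deficit xs (suc i) ≤ deficit xs i + deficit xs (2 + i)
deficit-convex []  i = z≤n
deficit-convex [-] zero = z≤n
deficit-convex {x ∷ xs} [-] (suc i) rewrite deficit-[] i = z≤n
deficit-convex {x ∷ y ∷ xs} (x≥y ∷ _) zero = begin
  2 * (y + sum xs)            ≡⟨ regroup y (sum xs) ⟩
  y + (y + sum xs) + sum xs   ≤⟨ +-monoˡ-≤ (sum xs) (+-monoˡ-≤ (y + sum xs) x≥y) ⟩
  x + (y + sum xs) + sum xs   ∎
  where
  open ≤-Reasoning
  regroup : ∀ y s → 2 * (y + s) ≡ y + (y + s) + s
  regroup = solve-∀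
deficit-convex (_ ∷ xs≥) (suc i) = deficit-convex xs≥ i

-- Entries are differences of consecutive tail sums; positivity excludes trailing zeros, which tail
-- sums cannot detect.
deficit-injective : ∀ {xs ys} → All (0 <_) xs → All (0 <_) ys →
  (∀ i → deficit xs i ≡ deficit ys i) → xs ≡ ys
deficit-injective [] [] _ = refl
deficit-injective [] (y>0 ∷ _) eq =
  contradiction (m+n≡0⇒m≡0 _ (sym (eq 0))) (m<n⇒n≢0 y>0)
deficit-injective (x>0 ∷ _) [] eq =
  contradiction (m+n≡0⇒m≡0 _ (eq 0)) (m<n⇒n≢0 x>0)
deficit-injective (_ ∷ xs>0) (_ ∷ ys>0) eq
  with refl ← deficit-injective xs>0 ys>0 (eq ∘ suc) =
  cong (_∷ _) (+-cancelʳ-≡ _ _ _ (eq 0))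

-- Concave sequences of natural numbers on {0, ..., N}.

ConcaveUpTo : ℕ → (ℕ → ℕ) → Set
ConcaveUpTo N G = ∀ i → 2 + i ≤ N → G i + G (2 + i) ≤ 2 * G (1 + i)

n∸m≡1+n∸1+m : ∀ {m n} → m < n → n ∸ m ≡ suc (n ∸ suc m)
n∸m≡1+n∸1+m m<n = +-∸-assoc 1 m<n

-- Reflection exchanges the two sides of the plateau, so results for one side transfer to the other.
concave-reverse : ∀ {N} G → ConcaveUpTo N G → ConcaveUpTo N (λ i → G (N ∸ i))
concave-reverse {N} G conc i 2+i≤N = begin
  G (N ∸ i) + G k           ≡⟨ cong (λ x → G x + G k) N∸i≡2+k ⟩
  G (2 + k) + G k           ≡⟨ +-comm (G (2 + k)) (G k) ⟩
  G k + G (2 + k)           ≤⟨ conc k (subst (_≤ N) N∸i≡2+k (m∸n≤m N i)) ⟩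
  2 * G (1 + k)             ≡⟨ cong (λ x → 2 * G x) (n∸m≡1+n∸1+m 2+i≤N) ⟨
  2 * G (N ∸ (1 + i))       ∎
  where
  open ≤-Reasoning
  k = N ∸ (2 + i)
  N∸i≡2+k : N ∸ i ≡ 2 + k
  N∸i≡2+k = trans (n∸m≡1+n∸1+m (<⇒≤ 2+i≤N)) (cong suc (n∸m≡1+n∸1+m 2+i≤N))

-- All increments before an increase are increases as well, and G 0 ≥ 0.
ascent-height : ∀ {N} G → ConcaveUpTo N G →
  ∀ k → suc k ≤ N → G k < G (suc k) → k < G (suc k)
ascent-height G conc zero    _     up = ≤-<-trans z≤n up
ascent-height G conc (suc k) 2+k≤N up =
  ≤-<-trans (ascent-height G conc k (<⇒≤ 2+k≤N) up′) up
  where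
  open ≤-Reasoning
  up′ : G k < G (suc k)
  up′ = +-cancelʳ-< (G (2 + k)) _ _ (begin-strict
    G k + G (2 + k)             ≤⟨ conc k 2+k≤N ⟩
    G (1 + k) + (G (1 + k) + 0) ≡⟨ cong (_+_ (G (1 + k))) (+-identityʳ (G (1 + k))) ⟩
    G (1 + k) + G (1 + k)       <⟨ +-monoʳ-< (G (1 + k)) up ⟩
    G (1 + k) + G (2 + k)       ∎)

-- An increase from `j` to `suc j` with `j` ≥ `c` would force `G (suc j)` above `c`, against the
-- bound.
antitone : ∀ {N c} G → ConcaveUpTo N G → (∀ i → G i ≤ c) →
  ∀ {i j} → c ≤ i → i ≤ j → j ≤ N → G j ≤ G i
antitone G conc bound {i} {zero}  _   z≤n _ = ≤-refl
antitone G conc bound {i} {suc j} c≤i i≤j j<N with m≤n⇒m<n∨m≡n i≤j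
... | inj₂ refl = ≤-refl
... | inj₁ (s≤s i≤j′) = ≤-trans
  (≮⇒≥ λ up → <⇒≱ (ascent-height G conc j j<N up)
                  (≤-trans (bound (suc j)) (≤-trans c≤i i≤j′)))
  (antitone G conc bound c≤i i≤j′ (<⇒≤ j<N))

monotone : ∀ {N c} G → ConcaveUpTo N G → (∀ i → G i ≤ c) → c ≤ N →
  ∀ {i j} → i ≤ j → j ≤ N ∸ c → G i ≤ G j
monotone {N} {c} G conc bound c≤N {i} {j} i≤j j≤ = subst₂ (λ x y → G x ≤ G y)
  (m∸[m∸n]≡n (≤-trans i≤j j≤N)) (m∸[m∸n]≡n j≤N)
  (antitone (λ i → G (N ∸ i)) (concave-reverse G conc) (λ i → bound (N ∸ i))
    (subst (_≤ N ∸ j) (m∸[m∸n]≡n c≤N) (∸-monoʳ-≤ N j≤)) (∸-monoʳ-≤ N i≤j) (m∸n≤m N i))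
  where
  j≤N : j ≤ N
  j≤N = ≤-trans j≤ (m∸n≤m N c)

-- Increments of a concave ascending sequence as a partition.

IncrementsOf : (M m : ℕ) (G : ℕ → ℕ) → List ℕ → Set
IncrementsOf M m G xs = ∀ i → i ≤ M → deficit xs i + G i ≡ m

-- The specification at 0 and 1 identifies `x` as G 2 - G 1, which concavity bounds by G 1 - G 0.
-- For `M` = 0 the maximum is already reached at 1, leaving no room for a positive `x`.
increment-decreases : ∀ M {m G x xs} → ConcaveUpTo (suc M) G → G (suc M) ≡ m → 0 < x →
  IncrementsOf M m (G ∘ suc) (x ∷ xs) → x ≤ G 1 ∸ G 0
increment-decreases zero {m} {G} {x} {xs} conc top x>0 spec = contradiction
  (m+n≡0⇒m≡0 x (+-cancelʳ-≡ (G 1) (x + sum xs) 0 (trans (spec 0 z≤n) (sym top))))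
  (m<n⇒n≢0 x>0)
increment-decreases (suc M) {m} {G} {x} {xs} conc top x>0 spec =
  m+n≤o⇒m≤o∸n x (+-cancelʳ-≤ (G 1) _ _ (begin
    x + G 0 + G 1      ≡⟨ regroup x (G 0) (G 1) ⟩
    G 0 + (x + G 1)    ≡⟨ cong (_+_ (G 0)) x+G1≡G2 ⟩
    G 0 + G 2          ≤⟨ conc 0 (s≤s (s≤s z≤n)) ⟩
    G 1 + (G 1 + 0)    ≡⟨ cong (_+_ (G 1)) (+-identityʳ (G 1)) ⟩
    G 1 + G 1          ∎))
  where
  open ≤-Reasoning
  regroup : ∀ x y z → x + y + z ≡ y + (x + z)
  regroup = solve-∀
  shift : ∀ x s g → s + (x + g) ≡ x + s + g
  shift = solve-∀
  x+G1≡G2 : x + G 1 ≡ G 2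
  x+G1≡G2 = +-cancelˡ-≡ (sum xs) _ _
    (trans (shift x (sum xs) (G 1)) (trans (spec 0 z≤n) (sym (spec 1 (s≤s z≤n)))))

-- Induction from the right end, adding the first increment in front. Zero increments get no entry,
-- so that parts stay positive; by concavity they can only come last.
increments : ∀ M {m G} → ConcaveUpTo M G → (∀ i → i < M → G i ≤ G (suc i)) → G M ≡ m →
  ∃ λ xs → All (0 <_) xs × Linked _≥_ xs × IncrementsOf M m G xs
increments zero conc mono top = [] , [] , [] , λ { zero _ → top }
increments (suc M) {m} {G} conc mono top
  with xs , xs>0 , xs≥ , spec ← increments M {m} {G ∘ suc}
         (λ i le → conc (suc i) (s≤s le)) (λ i lt → mono (suc i) (s≤s lt)) top
  = prepend (G 1 ∸ G 0) refl xs>0 (link xs>0 xs≥ spec) spec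
  where
  G0≤G1 : G 0 ≤ G 1
  G0≤G1 = mono 0 z<s

  link : ∀ {xs} → All (0 <_) xs → Linked _≥_ xs → IncrementsOf M m (G ∘ suc) xs →
    Linked _≥_ (G 1 ∸ G 0 ∷ xs)
  link []        _   _    = [-]
  link (x>0 ∷ _) xs≥ spec = increment-decreases M {G = G} conc top x>0 spec ∷ xs≥

  prepend : ∀ d → G 1 ∸ G 0 ≡ d → ∀ {xs} → All (0 <_) xs → Linked _≥_ (G 1 ∸ G 0 ∷ xs) →
    IncrementsOf M m (G ∘ suc) xs →
    ∃ λ ys → All (0 <_) ys × Linked _≥_ ys × IncrementsOf (suc M) m G ys
  prepend zero d≡0 [] _ spec = [] , [] , [] , λ
    { zero    _        → trans (≤-antisym G0≤G1 (m∸n≡0⇒m≤n d≡0)) (spec 0 z≤n)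
    ; (suc i) (s≤s le) → trans (cong (_+ G (suc i)) (sym (deficit-[] i))) (spec i le)
    }
  prepend zero d≡0 (x>0 ∷ _) (d≥x ∷ _) spec =
    contradiction (≤-trans d≥x (≤-reflexive d≡0)) (<⇒≱ x>0)
  prepend (suc d) d≡ {xs} xs>0 d∷xs≥ spec =
    G 1 ∸ G 0 ∷ xs , subst (0 <_) (sym d≡) z<s ∷ xs>0 , d∷xs≥ , λ
    { zero    _        → trans (regroup (G 1 ∸ G 0) (sum xs) (G 0))
                           (trans (cong (_+_ (sum xs)) (m∸n+n≡m G0≤G1)) (spec 0 z≤n))
    ; (suc i) (s≤s le) → spec i le
    }
    where
    regroup : ∀ d s g → d + s + g ≡ s + (d + g)
    regroup = solve-∀

ascending-part : ∀ {N c} G → ConcaveUpTo N G → (∀ i → G i ≤ c) → c ≤ N →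
  ∃ λ xs → All (0 <_) xs × Linked _≥_ xs × IncrementsOf (N ∸ c) (G (N ∸ c)) G xs
ascending-part {N} {c} G conc bound c≤N = increments (N ∸ c)
  (λ i le → conc i (≤-trans le (m∸n≤m N c)))
  (λ i lt → monotone G conc bound c≤N (n≤1+n i) lt)
  refl

-- Partitions of the numbers below a bound.

PartsBelow : ℕ → Set
PartsBelow k = Σ (Fin k) λ j → Fin (a (toℕ j))

module _ {k : ℕ} where

  -- Partitions are coded by indices into their enumeration, so that equality of codes is
  -- propositional and ignores proofs of `IsPartition`.
  parts : PartsBelow k → List ℕ
  parts (j , i) = proj₁ (Inverse.from (proj₂ (partitions-finite (toℕ j))) i)

  parts-isPartition : (d : PartsBelow k) → IsPartition (toℕ (proj₁ d)) (parts d)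
  parts-isPartition (j , i) = proj₂ (Inverse.from (proj₂ (partitions-finite (toℕ j))) i)

  parts>0 : ∀ d → All (0 <_) (parts d)
  parts>0 d = proj₁ (parts-isPartition d)

  parts-decreasing : ∀ d → Linked _≥_ (parts d)
  parts-decreasing d = proj₁ (proj₂ (parts-isPartition d))

  sum-parts : ∀ d → sum (parts d) ≡ toℕ (proj₁ d)
  sum-parts d = proj₂ (proj₂ (parts-isPartition d))

  sum-parts< : ∀ d → sum (parts d) < k
  sum-parts< d = subst (_< k) (sym (sum-parts d)) (Fin.toℕ<n (proj₁ d))

  length-parts< : ∀ d → length (parts d) < k
  length-parts< d = ≤-<-trans (length≤sum (parts>0 d)) (sum-parts< d)

  parts-injective : ∀ d e → parts d ≡ parts e → d ≡ e
  parts-injective d e eq = same-index d e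
    (Fin.toℕ-injective (trans (sym (sum-parts d)) (trans (cong sum eq) (sum-parts e)))) eq
    where
    same-index : ∀ d e → proj₁ d ≡ proj₁ e → parts d ≡ parts e → d ≡ e
    same-index (j , i) (.j , i′) refl eq = cong (j ,_)
      (trans (sym (strictlyInverseˡ i)) (trans (to-cong eq) (strictlyInverseˡ i′)))
      where open Inverse (proj₂ (partitions-finite (toℕ j)))

  parts-surjective : ∀ {xs} → All (0 <_) xs → Linked _≥_ xs → sum xs < k →
    ∃ λ d → parts d ≡ xs
  parts-surjective {xs} xs>0 xs≥ sum< =
    (fromℕ< sum< , to x) , strictlyInverseʳ x
    where
    open Inverse (proj₂ (partitions-finite (toℕ (fromℕ< sum<))))
    x : Σ (List ℕ) (IsPartition (toℕ (fromℕ< sum<)))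
    x = xs , xs>0 , xs≥ , sym (Fin.toℕ-fromℕ< sum<)

-- Counting profiles.

Σ-Fin↔ : ∀ (A : ℕ → Set) (b : ℕ → ℕ) → (∀ i → A i ↔ Fin (b i)) →
  ∀ k → Σ (Fin k) (A ∘ toℕ) ↔ Fin (sum (map b (upTo k)))
Σ-Fin↔ A b A↔ k = subst (λ l → _ ↔ Fin (sum l)) (sym (map-upTo b k)) (go A b A↔ k)
  where
  split : ∀ (A : ℕ → Set) k →
    Σ (Fin (suc k)) (A ∘ toℕ) ↔ (A 0 ⊎ Σ (Fin k) (A ∘ suc ∘ toℕ))
  split A k = mk↔ₛ′
    (λ { (Fin.zero , x) → inj₁ x ; (Fin.suc i , x) → inj₂ (i , x) })
    (λ { (inj₁ x) → Fin.zero , x ; (inj₂ (i , x)) → Fin.suc i , x })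
    (λ { (inj₁ _) → refl ; (inj₂ _) → refl })
    (λ { (Fin.zero , _) → refl ; (Fin.suc _ , _) → refl })

  -- General in `A` and `b`, so that the induction can split off index 0 and shift both by `suc`.
  go : ∀ A b → (∀ i → A i ↔ Fin (b i)) →
    ∀ k → Σ (Fin k) (A ∘ toℕ) ↔ Fin (sum (applyUpTo b k))
  go A b A↔ zero    = mk↔ₛ′ (λ ()) (λ ()) (λ ()) (λ ())
  go A b A↔ (suc k) = ↔-trans (split A k)
    (↔-trans (A↔ 0 ⊎-↔ go (A ∘ suc) (b ∘ suc) (A↔ ∘ suc) k) (↔-sym Fin.+↔⊎))

-- The triples (m , λ , μ), with Fin p standing for {1, …, p}.
Profile : ℕ → Set
Profile p = Σ (Fin p) λ m → PartsBelow (suc (toℕ m)) × PartsBelow (suc (toℕ m))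

-- For a fixed maximum m, λ and μ range independently over the partitions of 0, ..., m - 1, which
-- gives the square.
profile-count : ∀ p →
  Profile p ↔ Fin (sum (map (λ m → sum (map a (upTo m)) ^ 2) (map suc (upTo p))))
profile-count p = subst (λ l → Profile p ↔ Fin (sum l)) (map-∘ (upTo p))
  (Σ-Fin↔ (λ m → PartsBelow (suc m) × PartsBelow (suc m)) _ square p)
  where
  square : ∀ m → (PartsBelow (suc m) × PartsBelow (suc m)) ↔ Fin (sum (map a (upTo (suc m))) ^ 2)
  -- `s ^ 2` unfolds to s * (s * 1), hence the rewriting of the inner factor.
  square m = subst (λ x → (PartsBelow (suc m) × PartsBelow (suc m)) ↔ Fin (s * x)) (sym (*-identityʳ s))
    (↔-trans (below ×-↔ below) (↔-sym Fin.*↔×))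
    where
    s = sum (map a (upTo (suc m)))
    below : PartsBelow (suc m) ↔ Fin s
    below = Σ-Fin↔ (Fin ∘ a) a (λ _ → ↔-refl) (suc m)

-- Concavity over ℤ on `Fin` and concavity over ℕ.

second-difference⇔ : ∀ x y z →
  x + z ≤ 2 * y ⇔ (+ suc x ℤ.+ + suc z) ℤ.- + 2 ℤ.* + suc y ℤ.≤ 0ℤ
second-difference⇔ x y z = mk⇔
  -- Passing from values counted from 0 to values counted from 1 adds 2 to both sides.
  (λ le → ℤ.i≤j⇒i-j≤0 (subst (+ (suc x + suc z) ℤ.≤_) (ℤ.pos-* 2 (suc y))
    (ℤ.+≤+ (subst₂ _≤_ (lhs x z) (rhs y) (+-monoʳ-≤ 2 le)))))
  (λ le → +-cancelˡ-≤ 2 _ _ (subst₂ _≤_ (sym (lhs x z)) (sym (rhs y))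
    (ℤ.drop‿+≤+ (subst (+ (suc x + suc z) ℤ.≤_) (sym (ℤ.pos-* 2 (suc y)))
      (ℤ.i-j≤0⇒i≤j le)))))
  where
  lhs : ∀ x z → 2 + (x + z) ≡ suc x + suc z
  lhs = solve-∀
  rhs : ∀ y → 2 + 2 * y ≡ 2 * suc y
  rhs = solve-∀

module _ {N p : ℕ} (f : Fin (suc N) → Fin p) (G : ℕ → ℕ) (f≗G : ∀ i → toℕ (f i) ≡ G (toℕ i)) where

  concaveUpTo⇒concave : ConcaveUpTo N G → Concave f
  concaveUpTo⇒concave conc h i j i≡ j≡ =
    Equivalence.to (second-difference⇔ (toℕ (f h)) (toℕ (f i)) (toℕ (f j)))
    (subst₂ _≤_ (sym (cong₂ _+_ (f≗G h) (trans (f≗G j) (cong G 2+h))))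
      (cong (2 *_) (sym (trans (f≗G i) (cong G (suc-injective i≡)))))
      (conc (toℕ h) (subst (_≤ N) 2+h (s≤s⁻¹ (Fin.toℕ<n j)))))
    where
    2+h : toℕ j ≡ 2 + toℕ h
    2+h = trans (suc-injective j≡) i≡

  concave⇒concaveUpTo : Concave f → ConcaveUpTo N G
  concave⇒concaveUpTo conc i 2+i≤N =
    subst₂ _≤_ (cong₂ _+_ (at i<) (at 2+i<)) (cong (2 *_) (at 1+i<))
      (Equivalence.from (second-difference⇔
          (toℕ (f (fromℕ< i<))) (toℕ (f (fromℕ< 1+i<))) (toℕ (f (fromℕ< 2+i<))))
        (conc (fromℕ< i<) (fromℕ< 1+i<) (fromℕ< 2+i<)
          (cong suc (trans (Fin.toℕ-fromℕ< 1+i<) (cong suc (sym (Fin.toℕ-fromℕ< i<)))))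
          (cong suc (trans (Fin.toℕ-fromℕ< 2+i<) (cong suc (sym (Fin.toℕ-fromℕ< 1+i<)))))))
    where
    2+i< : 2 + i < suc N
    2+i< = s≤s 2+i≤N
    1+i< : 1 + i < suc N
    1+i< = <⇒≤ 2+i<
    i< : i < suc N
    i< = <⇒≤ 1+i<
    at : ∀ {i} (lt : i < suc N) → toℕ (f (fromℕ< lt)) ≡ G i
    at lt = trans (f≗G (fromℕ< lt)) (cong G (Fin.toℕ-fromℕ< lt))

-- The value at i, continued constantly beyond i = N.
extend : ∀ {N p} → (Fin (suc N) → Fin p) → ℕ → ℕ
extend {N} f i = toℕ (f (fromℕ< (s≤s (m⊓n≤n i N))))

extend-toℕ : ∀ {N p} (f : Fin (suc N) → Fin p) i → toℕ (f i) ≡ extend f (toℕ i)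
extend-toℕ {N} f i = cong (toℕ ∘ f) (Fin.toℕ-injective
  (sym (trans (Fin.toℕ-fromℕ< _) (m≤n⇒m⊓n≡m (s≤s⁻¹ (Fin.toℕ<n i))))))

extend≤ : ∀ {N c} (f : Fin (suc N) → Fin (suc c)) i → extend f i ≤ c
extend≤ {N} f i = s≤s⁻¹ (Fin.toℕ<n (f (fromℕ< (s≤s (m⊓n≤n i N)))))

-- The bijection between profiles and concave functions.

module Correspondence {c N : ℕ} (c≤N∸c : c ≤ N ∸ c) where

  c≤N : c ≤ N
  c≤N = ≤-trans c≤N∸c (m∸n≤m N c)

  -- For t = (m , λ , μ), the tail sums of λ and μ in the formula for f. The field
  -- m is the maximal value minus one, hence so is the height.
  left right total height : Profile (suc c) → ℕ → ℕ
  left   (_ , d , _)   = deficit (parts d)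
  right  (_ , _ , e) i = deficit (parts e) (N ∸ i)
  total  t           i = left t i + right t i
  height t           i = toℕ (proj₁ t) ∸ total t i

  -- A partition of a number at most `c` has at most `c` parts.
  left≡0 : ∀ t {i} → c ≤ i → left t i ≡ 0
  left≡0 (m , d , _) c≤i = deficit-vanishes (parts d)
    (≤-trans (s≤s⁻¹ (length-parts< d)) (≤-trans (s≤s⁻¹ (Fin.toℕ<n m)) c≤i))

  right≡0 : ∀ t {i} → i ≤ N ∸ c → right t i ≡ 0
  right≡0 (m , _ , e) {i} i≤ = deficit-vanishes (parts e)
    (≤-trans (s≤s⁻¹ (length-parts< e)) (≤-trans (s≤s⁻¹ (Fin.toℕ<n m))
      (subst (_≤ N ∸ i) (m∸[m∸n]≡n c≤N) (∸-monoʳ-≤ N i≤))))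

  total-left : ∀ t {i} → i ≤ c → total t i ≡ left t i
  total-left t {i} i≤c =
    trans (cong (_+_ (left t i)) (right≡0 t (≤-trans i≤c c≤N∸c))) (+-identityʳ (left t i))

  total-right : ∀ t {i} → c ≤ i → total t i ≡ right t i
  total-right t {i} c≤i = cong (_+ right t i) (left≡0 t c≤i)

  -- At every `i` one of the two tails vanishes and the other is at most m. Hence the truncated
  -- subtraction in `height` is exact.
  total≤ : ∀ t i → total t i ≤ toℕ (proj₁ t)
  total≤ t@(_ , d , e) i with ≤-total i c
  ... | inj₁ i≤c = subst (_≤ _) (sym (total-left t i≤c))
                     (≤-trans (deficit≤sum (parts d) i) (s≤s⁻¹ (sum-parts< d)))
  ... | inj₂ c≤i = subst (_≤ _) (sym (total-right t c≤i))
                     (≤-trans (deficit≤sum (parts e) (N ∸ i)) (s≤s⁻¹ (sum-parts< e)))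

  height+total : ∀ t i → height t i + total t i ≡ toℕ (proj₁ t)
  height+total t i = m∸n+n≡m (total≤ t i)

  right-convex : ∀ t i → 2 + i ≤ N → 2 * right t (1 + i) ≤ right t i + right t (2 + i)
  right-convex t@(_ , _ , e) i 2+i≤N
    rewrite n∸m≡1+n∸1+m (<⇒≤ 2+i≤N) | n∸m≡1+n∸1+m 2+i≤N =
    ≤-trans (deficit-convex (parts-decreasing e) (N ∸ (2 + i)))
            (≤-reflexive (+-comm (deficit (parts e) (N ∸ (2 + i))) _))

  -- A constant minus two convex sequences is concave. Adding the totals at `i` and `2 + i` to both
  -- sides keeps the computation in ℕ, since height plus total is constant.
  height-concave : ∀ t → ConcaveUpTo N (height t)
  height-concave t@(m , d , _) i 2+i≤N = +-cancelʳ-≤ (D 0 + D 2) _ _ (begin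
    H 0 + H 2 + (D 0 + D 2)             ≡⟨ swap (H 0) (H 2) (D 0) (D 2) ⟩
    (H 0 + D 0) + (H 2 + D 2)           ≡⟨ cong₂ _+_
      (trans (height+total t i) (sym (height+total t (1 + i))))
      (trans (height+total t (2 + i)) (sym (height+total t (1 + i)))) ⟩
    (H 1 + D 1) + (H 1 + D 1)           ≡⟨ double (H 1) (L 1) (R 1) ⟩
    2 * H 1 + (2 * L 1 + 2 * R 1)       ≤⟨ +-monoʳ-≤ (2 * H 1)
      (+-mono-≤ (deficit-convex (parts-decreasing d) i) (right-convex t i 2+i≤N)) ⟩
    2 * H 1 + ((L 0 + L 2) + (R 0 + R 2)) ≡⟨ cong (_+_ (2 * H 1)) (swap (L 0) (L 2) (R 0) (R 2)) ⟩
    2 * H 1 + (D 0 + D 2)               ∎)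
    where
    open ≤-Reasoning
    H D L R : ℕ → ℕ
    H k = height t (k + i)
    L k = left t (k + i)
    R k = right t (k + i)
    D k = total t (k + i)
    swap : ∀ w x y z → w + x + (y + z) ≡ (w + y) + (x + z)
    swap = solve-∀
    double : ∀ h l r → (h + (l + r)) + (h + (l + r)) ≡ 2 * h + (2 * l + 2 * r)
    double = solve-∀

  function : Profile (suc c) → Fin (suc N) → Fin (suc c)
  function t i = fromℕ< (≤-<-trans (m∸n≤m _ (total t (toℕ i))) (Fin.toℕ<n (proj₁ t)))

  toℕ-function : ∀ t i → toℕ (function t i) ≡ height t (toℕ i)
  toℕ-function t i = Fin.toℕ-fromℕ< _

  height-peak : ∀ t → height t c ≡ toℕ (proj₁ t)
  height-peak t = cong (toℕ (proj₁ t) ∸_) (trans (total-left t ≤-refl) (left≡0 t ≤-refl))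

  -- The value at `c`, where both tails vanish, gives m and thereby all totals. These give λ at
  -- positions up to `c` and μ at positions from `c` on; elsewhere each tail is zero.
  height-injective : ∀ t u → (∀ i → i ≤ N → height t i ≡ height u i) → t ≡ u
  height-injective t@(m , d , e) u@(m′ , d′ , e′) eq
    with refl ← Fin.toℕ-injective {i = m} {m′}
           (trans (sym (height-peak t)) (trans (eq c c≤N) (height-peak u))) =
    cong (m ,_) (cong₂ _,_
      (parts-injective d d′ (deficit-injective (parts>0 d) (parts>0 d′) left≡))
      (parts-injective e e′ (deficit-injective (parts>0 e) (parts>0 e′) right≡)))
    where
    total≡ : ∀ i → i ≤ N → total t i ≡ total u i
    total≡ i i≤N = +-cancelˡ-≡ (height t i) _ _
      (trans (height+total t i) (sym (trans (cong (_+ total u i) (eq i i≤N)) (height+total u i))))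

    left≡ : ∀ i → left t i ≡ left u i
    left≡ i with ≤-total i c
    ... | inj₁ i≤c = trans (sym (total-left t i≤c)) (trans (total≡ i (≤-trans i≤c c≤N)) (total-left u i≤c))
    ... | inj₂ c≤i = trans (left≡0 t c≤i) (sym (left≡0 u c≤i))

    right≡′ : ∀ i → i ≤ N → right t i ≡ right u i
    right≡′ i i≤N with ≤-total c i
    ... | inj₁ c≤i = trans (sym (total-right t c≤i)) (trans (total≡ i i≤N) (total-right u c≤i))
    ... | inj₂ i≤c = trans (right≡0 t (≤-trans i≤c c≤N∸c)) (sym (right≡0 u (≤-trans i≤c c≤N∸c)))

    right≡ : ∀ i → deficit (parts e) i ≡ deficit (parts e′) i
    right≡ i with ≤-total i N
    ... | inj₁ i≤N = subst (λ k → deficit (parts e) k ≡ deficit (parts e′) k)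
                       (m∸[m∸n]≡n i≤N) (right≡′ (N ∸ i) (m∸n≤m N i))
    -- Such positions lie outside the domain of the heights, but each partition has at most `c` ≤
    -- `N` parts.
    ... | inj₂ N≤i = trans (deficit-vanishes (parts e) (long e)) (sym (deficit-vanishes (parts e′) (long e′)))
      where
      long : ∀ (e : PartsBelow (suc (toℕ m))) → length (parts e) ≤ i
      long e = ≤-trans (s≤s⁻¹ (length-parts< e))
        (≤-trans (s≤s⁻¹ (Fin.toℕ<n m)) (≤-trans c≤N N≤i))

  -- λ comes from the increments of `G` up to N - c, and μ from those of its reflection. Both sides
  -- climb to the same maximum because `G c` equals `G (N ∸ c)`.
  height-surjective : ∀ G → ConcaveUpTo N G → (∀ i → G i ≤ c) →
    ∃ λ t → ∀ i → i ≤ N → height t i ≡ G i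
  height-surjective G conc bound =
    assemble (ascending-part G conc bound c≤N)
             (ascending-part (λ i → G (N ∸ i)) (concave-reverse G conc) (λ i → bound (N ∸ i)) c≤N)
    where
    plateau : G c ≡ G (N ∸ c)
    plateau = ≤-antisym (monotone G conc bound c≤N c≤N∸c ≤-refl)
                        (antitone G conc bound ≤-refl c≤N∸c (m∸n≤m N c))

    m : Fin (suc c)
    m = fromℕ< (s≤s (bound c))

    toℕ-m : toℕ m ≡ G c
    toℕ-m = Fin.toℕ-fromℕ< (s≤s (bound c))

    below : ∀ xs {g k} → sum xs + g ≡ k → k ≡ G c → sum xs < suc (toℕ m)
    below xs {g} eq k≡ = s≤s (≤-trans (m≤m+n (sum xs) g) (≤-reflexive (trans eq (trans k≡ (sym toℕ-m)))))

    remove : ∀ x {g k} → x + g ≡ k → k ∸ x ≡ g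
    remove x {g} refl = m+n∸m≡n x g

    height≡ : ∀ d e → IncrementsOf (N ∸ c) (G (N ∸ c)) G (parts d) →
      IncrementsOf (N ∸ c) (G (N ∸ (N ∸ c))) (λ i → G (N ∸ i)) (parts e) →
      ∀ i → i ≤ N → G c ∸ total (m , d , e) i ≡ G i
    height≡ d e d-spec e-spec i i≤N with ≤-total i c
    ... | inj₁ i≤c = trans (cong₂ _∸_ plateau (total-left (m , d , e) i≤c))
                       (remove _ (d-spec i (≤-trans i≤c c≤N∸c)))
    -- The reflected sequence ends at `G (N ∸ (N ∸ c))`, which is `G c`.
    ... | inj₂ c≤i = trans
      (cong₂ _∸_ (cong G (sym (m∸[m∸n]≡n c≤N))) (total-right (m , d , e) c≤i))
      (trans (remove _ (e-spec (N ∸ i) (∸-monoʳ-≤ N c≤i))) (cong G (m∸[m∸n]≡n i≤N)))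

    -- With both lists as variables, matching on `refl` can replace them by `parts d` and `parts e`.
    assemble :
      (∃ λ xs → All (0 <_) xs × Linked _≥_ xs × IncrementsOf (N ∸ c) (G (N ∸ c)) G xs) →
      (∃ λ ys → All (0 <_) ys × Linked _≥_ ys ×
                IncrementsOf (N ∸ c) (G (N ∸ (N ∸ c))) (λ i → G (N ∸ i)) ys) →
      ∃ λ t → ∀ i → i ≤ N → height t i ≡ G i
    assemble (xs , xs>0 , xs≥ , xs-spec) (ys , ys>0 , ys≥ , ys-spec)
      with d , refl ← parts-surjective xs>0 xs≥ (below xs (xs-spec 0 z≤n) (sym plateau))
         | e , refl ← parts-surjective ys>0 ys≥
                        (below ys (ys-spec 0 z≤n) (cong G (m∸[m∸n]≡n c≤N)))
      = (m , d , e) , λ i i≤N →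
          trans (cong (_∸ total (m , d , e) i) toℕ-m) (height≡ d e xs-spec ys-spec i i≤N)

  function-injective : ∀ t u → (∀ i → function t i ≡ function u i) → t ≡ u
  function-injective t u eq = height-injective t u λ i i≤N →
    trans (sym (at t i≤N)) (trans (cong toℕ (eq (fromℕ< (s≤s i≤N)))) (at u i≤N))
    where
    at : ∀ t {i} (i≤N : i ≤ N) → toℕ (function t (fromℕ< (s≤s i≤N))) ≡ height t i
    at t i≤N = trans (toℕ-function t (fromℕ< (s≤s i≤N)))
      (cong (height t) (Fin.toℕ-fromℕ< (s≤s i≤N)))

  function-surjective : ∀ f → Concave f → ∃ λ t → ∀ i → function t i ≡ f i
  function-surjective f f-concave = proj₁ preimage , λ i → Fin.toℕ-injective
    (trans (toℕ-function (proj₁ preimage) i)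
      (trans (proj₂ preimage (toℕ i) (s≤s⁻¹ (Fin.toℕ<n i))) (sym (extend-toℕ f i))))
    where
    preimage : ∃ λ t → ∀ i → i ≤ N → height t i ≡ extend f i
    preimage = height-surjective (extend f)
      (concave⇒concaveUpTo f (extend f) (extend-toℕ f) f-concave) (extend≤ f)

  bijection : Bijection (setoid (Profile (suc c))) (ConcaveFunctions (suc N) (suc c))
  bijection = record
    { to        = λ t → function t ,
                    concaveUpTo⇒concave (function t) (height t) (toℕ-function t) (height-concave t)
    ; cong      = λ { refl i → refl }
    ; bijective = (λ {t} {u} → function-injective t u)
                , λ { (f , f-concave) → proj₁ (function-surjective f f-concave)
                    , λ { refl → proj₂ (function-surjective f f-concave) } }
    }

theorem2p1 : (p : ℕ) → p ≥ 1 →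
    (n : ℕ) → n ≥ 1 → n > 2 * (p ∸ 1) →
    g₀ p n ≡ sum (map (λ m → sum (map a (upTo m)) ^ 2) (map suc (upTo p)))
-- The sum counts profiles and `g₀` counts concave functions; composing both enumerations with the
-- bijection relates two `Fin` types, whose sizes must agree.
theorem2p1 (suc c) _ (suc N) _ (s≤s 2c≤N) = sym (↔⇒≡
  (Compose.inverse (↔-sym (profile-count (suc c)))
    (Compose.inverse (Bijection⇒Inverse bijection)
      (proj₂ (concaveFunctions-finite (suc N) (suc c))))))
  where
  -- The bound n > 2(p - 1) becomes 2c ≤ N, so the plateau from c to N - c is nonempty.
  open Correspondence {c} {N} (m+n≤o⇒m≤o∸n c (subst (λ x → c + x ≤ N) (+-identityʳ c) 2c≤N))
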